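{- For every $\varepsilon>0$ there exists a $3$-connected simple cubic graph $G$ such that every traveling salesman tour of $G$ has length at least $(1.125-\varepsilon)\,|V(G)|$.
   Context: A traveling salesman tour (TSP tour) of a connected graph $G$ is a closed walk in $G$ that visits every vertex of $G$; its length is the number of edges of the walk counted with multiplicity. -}

module Defs where

open import Data.Nat as ℕ using (ℕ; _≤_)
open import Data.Fin using (Fin)
open import Data.Bool using (Bool; T; if_then_else_)
open import Data.List using (List; []; _∷_; _++_; length; map; allFin)
open import Data.Nat.ListAction using (sum)
open import Data.List.Membership.Propositional using (_∈_; _∉_)
open import Data.List.Relation.Unary.All using (All)
open import Data.List.Relation.Unary.Linked using (Linked)
open import Data.Product using (Σ; _×_)
open import Data.Sum using (_⊎_)
open import Relation.Binary.PropositionalEquality using (_≡_)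
open import Relation.Nullary using (¬_)

record SimpleGraph (n : ℕ) : Set where
  field
    adj     : Fin n → Fin n → Bool
    symm    : ∀ u v → adj u v ≡ adj v u
    irrefl  : ∀ v → ¬ T (adj v v)

module _ {n : ℕ} (G : SimpleGraph n) where
  open SimpleGraph G

  degree : Fin n → ℕ
  degree v = sum (map (λ w → if adj v w then 1 else 0) (allFin n))

  Cubic : Set
  Cubic = ∀ v → degree v ≡ 3

  -- A walk from u to v, written as the list ws of vertices after u:
  -- the walk is u ∷ ws, consecutive vertices are adjacent, and it ends at v.
  -- Its length (number of edges, with multiplicity) is length ws.
  IsWalk : Fin n → Fin n → List (Fin n) → Set
  IsWalk u v ws =
    Linked (λ x y → T (adj x y)) (u ∷ ws)
    × ((ws ≡ [] × u ≡ v) ⊎ Σ (List (Fin n)) (λ ys → ws ≡ ys ++ (v ∷ [])))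

  ConnectedAvoiding : List (Fin n) → Set
  ConnectedAvoiding X =
    ∀ u v → u ∉ X → v ∉ X →
      Σ (List (Fin n)) (λ ws → IsWalk u v ws × All (_∉ X) ws)

  KConnected : ℕ → Set
  KConnected k = (k ℕ.< n) × (∀ (X : List (Fin n)) → length X ℕ.< k → ConnectedAvoiding X)

  IsTSPTour : Fin n → List (Fin n) → Set
  IsTSPTour v ws = IsWalk v v ws × (∀ u → u ∈ v ∷ ws)

{-# OPTIONS --safe #-}
module Submission where

-- Replace a vertex of a 3-connected cubic graph by the Petersen graph minus a
-- vertex.  The graph stays 3-connected and cubic and gains 8 vertices, while
-- its shortest tour grows by at least 9; iterating from K₄ gives the ratio 9/8.
-- To see the growth, contract the 9-vertex patch in a tour of the new graph.
-- This loses the edges inside the patch.  Each visit to the patch enters and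
-- leaves through one of its three terminals.  A visit using the same terminal
-- twice is, after contraction, a loop x–v–x and can be deleted, saving 2 more
-- edges, as long as v is visited otherwise.  A single walk between terminals
-- covering the patch has at least 9 edges, since the Petersen graph is not
-- Hamiltonian; two visits using different terminals share a terminal and merge
-- into one walk; three such visits have at least 3 edges each, since the
-- Petersen graph has girth 5; and every additional loop saves at least as many
-- edges as the splitting of the cover into separate walks can cost.

open import Defs

module Graphs where
  open import Data.Bool using (Bool; true; false; T; if_then_else_; _∧_; _∨_)
  open import Data.Bool.ListAction using (any)
  open import Data.Bool.Properties using (T-∧; T-∨) renaming (_≟_ to _≟ᵇ_)
  open import Data.Empty using (⊥-elim)
  open import Data.Nat using (ℕ; zero; suc; _+_; _*_; _≤_; _<_; z≤n; s≤s; s≤s⁻¹; _≤?_)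
  open import Data.Nat.ListAction using (sum)
  open import Data.Nat.Properties
  open import Data.Nat.Tactic.RingSolver using (solve-∀)
  open import Data.Fin using (Fin; zero; suc; splitAt; _↑ˡ_; _↑ʳ_; join)
  open import Data.Fin.Patterns
  open import Data.Fin.Properties
    using (all?; any?; injective⇒≤; splitAt-↑ˡ; splitAt-↑ʳ; splitAt⁻¹-↑ˡ; splitAt-join; join-splitAt;
      ↑ˡ-injective)
    renaming (_≟_ to _≟ᶠ_)
  open import Data.List
    using (List; []; _∷_; _++_; length; map; null; filter; allFin; concatMap; lookup)
  open import Data.List.Properties
    using (length-++; length-map; map-++; ++-assoc; map-tabulate; map-cong)
  open import Data.List.Membership.Propositional using (_∈_; _∉_; find)
  open import Data.List.Membership.Propositional.Properties
  import Data.List.Membership.DecPropositional as DecMembership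
  open import Data.List.Relation.Unary.All as All using (All; []; _∷_)
  open import Data.List.Relation.Unary.All.Properties using (all-filter; ¬Any⇒All¬)
  open import Data.List.Relation.Unary.Any as Any using (Any; here; there; index)
  open import Data.List.Relation.Unary.Any.Properties using (any⁺; lookup-index)
  open import Data.List.Relation.Unary.Linked using (Linked; [-]; _∷_)
  open import Data.Product using (Σ; ∃; _×_; _,_; proj₁; proj₂)
  open import Data.Sum as Sum using (_⊎_; inj₁; inj₂; [_,_]′)
  open import Data.Unit using (tt)
  open import Function using (_∘_; id; const; Equivalence)
  open import Relation.Binary.Construct.Closure.ReflexiveTransitive
    using (Star; _◅_; _◅◅_; gmap) renaming (ε to stop)
  open import Relation.Binary.PropositionalEquality
  open import Relation.Nullary
  open import Relation.Nullary.Decidable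
    using (from-yes; toWitness; fromWitness; isYes; ¬?; _→-dec_; _⊎-dec_; T?)
  open import Relation.Unary using (Pred; Decidable)

  open DecMembership (_≟ᶠ_ {9}) using (_∈?_)

  -- Walks as sequences of edges.

  module _ {V : Set} {R : V → V → Set} where

    targets : ∀ {u v} → Star R u v → List V
    targets stop = []
    targets (_◅_ {j = v} e w) = v ∷ targets w

    verts : ∀ {u v} → Star R u v → List V
    verts {u} w = u ∷ targets w

    len : ∀ {u v} → Star R u v → ℕ
    len w = length (targets w)

    len-◅◅ : ∀ {u v z} (a : Star R u v) (b : Star R v z) → len (a ◅◅ b) ≡ len a + len b
    len-◅◅ stop b = refl
    len-◅◅ (e ◅ a) b = cong suc (len-◅◅ a b)

    verts-◅◅⁺ˡ : ∀ {x u v z} (a : Star R u v) (b : Star R v z) → x ∈ verts a → x ∈ verts (a ◅◅ b)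
    verts-◅◅⁺ˡ stop b (here refl) = here refl
    verts-◅◅⁺ˡ (e ◅ a) b (here refl) = here refl
    verts-◅◅⁺ˡ (e ◅ a) b (there p) = there (verts-◅◅⁺ˡ a b p)

    verts-◅◅⁺ʳ : ∀ {x u v z} (a : Star R u v) (b : Star R v z) → x ∈ verts b → x ∈ verts (a ◅◅ b)
    verts-◅◅⁺ʳ stop b p = p
    verts-◅◅⁺ʳ (e ◅ a) b p = there (verts-◅◅⁺ʳ a b p)

    verts-◅◅⁻ : ∀ {x u v z} (a : Star R u v) (b : Star R v z) →
      x ∈ verts (a ◅◅ b) → x ∈ verts a ⊎ x ∈ verts b
    verts-◅◅⁻ stop b p = inj₂ p
    verts-◅◅⁻ (e ◅ a) b (here refl) = inj₁ (here refl)
    verts-◅◅⁻ (e ◅ a) b (there p) = Sum.map₁ there (verts-◅◅⁻ a b p)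

    reversal : (∀ {x y} → R x y → R y x) → ∀ {u v} (w : Star R u v) →
      Σ (Star R v u) λ w′ → len w′ ≡ len w × (∀ {x} → x ∈ verts w → x ∈ verts w′)
    reversal sy stop = stop , refl , λ p → p
    reversal sy {u} (e ◅ w) with reversal sy w
    ... | w′ , l , c =
      w′ ◅◅ back ,
      trans (len-◅◅ w′ back) (trans (+-comm (len w′) 1) (cong suc l)) ,
      λ { (here refl) → verts-◅◅⁺ʳ w′ back (there (here refl))
        ; (there p) → verts-◅◅⁺ˡ w′ back (c p) }
      where
      back = sy e ◅ stop

    split : ∀ {u v y} (w : Star R u v) → y ∈ verts w →
      Σ (Star R u y) λ a → Σ (Star R y v) λ b → w ≡ a ◅◅ b
    split w (here refl) = stop , w , refl
    split (e ◅ w) (there p) with split w p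
    ... | a , b , refl = e ◅ a , b , refl

    rotate : ∀ {u y} (w : Star R u u) → y ∈ verts w →
      Σ (Star R y y) λ w′ → len w′ ≡ len w × (∀ {x} → x ∈ verts w → x ∈ verts w′)
    rotate w p with split w p
    ... | a , b , refl =
      b ◅◅ a ,
      trans (len-◅◅ b a) (trans (+-comm (len b) (len a)) (sym (len-◅◅ a b))) ,
      λ q → Sum.[ verts-◅◅⁺ʳ b a , verts-◅◅⁺ˡ b a ] (verts-◅◅⁻ a b q)

  targets-gmap : ∀ {V W : Set} {R : V → V → Set} {S : W → W → Set} (f : V → W)
    (g : ∀ {x y} → R x y → S (f x) (f y)) {u v} (w : Star R u v) →
    targets (gmap {U = S} f g w) ≡ map f (targets w)
  targets-gmap f g stop = refl
  targets-gmap f g (e ◅ w) = cong (_ ∷_) (targets-gmap f g w)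

  -- Distinct elements occupy distinct positions, so choosing a position for each element is
  -- injective.
  covering⇒length≥ : ∀ {n} (xs : List (Fin n)) → (∀ i → i ∈ xs) → n ≤ length xs
  covering⇒length≥ xs c = injective⇒≤ {f = λ i → index (c i)} λ {i} {j} eq →
    trans (lookup-index (c i)) (trans (cong (lookup xs) eq) (sym (lookup-index (c j))))

  -- The patch and the walks that cover it.

  -- The Petersen graph without a vertex whose neighbours are the terminals.
  patchNbrs : Fin 9 → List (Fin 9)
  patchNbrs 0F = 1F ∷ 2F ∷ 3F ∷ []
  patchNbrs 1F = 0F ∷ 4F ∷ 5F ∷ []
  patchNbrs 2F = 0F ∷ 6F ∷ 7F ∷ []
  patchNbrs 3F = 0F ∷ 8F ∷ []
  patchNbrs 4F = 1F ∷ 6F ∷ 8F ∷ []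
  patchNbrs 5F = 1F ∷ 7F ∷ []
  patchNbrs 6F = 2F ∷ 4F ∷ []
  patchNbrs 7F = 2F ∷ 5F ∷ 8F ∷ []
  patchNbrs 8F = 3F ∷ 4F ∷ 7F ∷ []

  terminal : Fin 3 → Fin 9
  terminal 0F = 3F
  terminal 1F = 5F
  terminal 2F = 6F

  patchAdj : Fin 9 → Fin 9 → Bool
  patchAdj p q = isYes (q ∈? patchNbrs p)

  PatchEdge : Fin 9 → Fin 9 → Set
  PatchEdge p q = T (patchAdj p q)

  patchAdj-sym : ∀ p q → patchAdj p q ≡ patchAdj q p
  patchAdj-sym = from-yes (all? λ p → all? λ q → patchAdj p q ≟ᵇ patchAdj q p)

  PatchEdge-sym : ∀ {p q} → PatchEdge p q → PatchEdge q p
  PatchEdge-sym {p} {q} = subst T (patchAdj-sym p q)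

  terminal-injective : ∀ i j → terminal i ≡ terminal j → i ≡ j
  terminal-injective = from-yes (all? λ i → all? λ j → (terminal i ≟ᶠ terminal j) →-dec (i ≟ᶠ j))

  -- Such an edge would close a triangle through the removed vertex of the Petersen graph.
  terminal-nonadjacent : ∀ i j → ¬ PatchEdge (terminal i) (terminal j)
  terminal-nonadjacent = from-yes (all? λ i → all? λ j → ¬? (T? (patchAdj (terminal i) (terminal j))))

  -- A common neighbour of two different terminals would close a 4-cycle through the removed vertex.
  terminal-common-nbr : ∀ i j p → PatchEdge (terminal i) p → PatchEdge p (terminal j) → i ≡ j
  terminal-common-nbr = from-yes (all? λ i → all? λ j → all? λ p →
    T? (patchAdj (terminal i) p) →-dec (T? (patchAdj p (terminal j)) →-dec (i ≟ᶠ j)))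

  -- The ends are given by equations, since the indices `terminal i` and `terminal j` would obstruct
  -- matching on `stop`.
  terminal-distance : ∀ {p q} (w : Star PatchEdge p q) i j →
    p ≡ terminal i → q ≡ terminal j → i ≢ j → 3 ≤ len w
  terminal-distance stop i j refl e i≢j = ⊥-elim (i≢j (terminal-injective i j e))
  terminal-distance (e ◅ stop) i j refl refl i≢j = ⊥-elim (terminal-nonadjacent i j e)
  terminal-distance (e ◅ f ◅ stop) i j refl refl i≢j = ⊥-elim (i≢j (terminal-common-nbr i j _ e f))
  terminal-distance (_ ◅ _ ◅ _ ◅ _) i j _ _ _ = s≤s (s≤s (s≤s z≤n))

  isTerminal : Fin 9 → Bool
  isTerminal q = isYes (q ∈? map terminal (allFin 3))

  _∖_ : List (Fin 9) → Fin 9 → List (Fin 9)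
  xs ∖ p = filter (λ q → ¬? (p ≟ᶠ q)) xs

  -- Decides whether some walk with at most k edges leads from p to a terminal
  -- and visits all of xs.
  reaches : ℕ → Fin 9 → List (Fin 9) → Bool
  reaches zero p xs = null xs ∧ isTerminal p
  reaches (suc k) p xs = (null xs ∧ isTerminal p) ∨ any (λ q → reaches k q (xs ∖ q)) (patchNbrs p)

  -- Turns a walk into a success of the search, so that a failing search excludes the walk.
  reaches-complete : ∀ k {p q} (w : Star PatchEdge p q) xs → len w ≤ k → T (isTerminal q) →
    (∀ {x} → x ∈ xs → x ∈ targets w) → T (reaches k p xs)
  reaches-complete zero stop [] _ t c = t
  reaches-complete zero stop (x ∷ xs) _ t c with c (here refl)
  ... | ()
  reaches-complete (suc k) {p} stop [] _ t c = Equivalence.from (T-∨ {isTerminal p}) (inj₁ t)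
  reaches-complete (suc k) stop (x ∷ xs) _ t c with c (here refl)
  ... | ()
  reaches-complete (suc k) {p} (_◅_ {j = q} e w) xs (s≤s l) t c =
    Equivalence.from (T-∨ {null xs ∧ isTerminal p})
      (inj₂ (any⁺ _ (found (toWitness {a? = q ∈? patchNbrs p} e))))
    where
    rest : ∀ {x} → x ∈ (xs ∖ q) → x ∈ targets w
    rest {x} m with ∈-filter⁻ (λ y → ¬? (q ≟ᶠ y)) {xs = xs} m
    ... | x∈ , q≢x with c x∈
    ... | here refl = ⊥-elim (q≢x refl)
    ... | there r = r
    found : ∀ {ys} → q ∈ ys → Any (λ r → T (reaches k r (xs ∖ r))) ys
    found (here refl) = here (reaches-complete k w (xs ∖ q) l t rest)
    found (there m) = there (found m)

  -- Nine vertices on at most 8 edges would form a Hamiltonian path between terminals, which the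
  -- removed vertex closes to a Hamiltonian cycle of the Petersen graph. The start is taken off the
  -- list because `reaches` only counts later vertices.
  no-short-cover : ∀ i → ¬ T (reaches 8 (terminal i) (allFin 9 ∖ terminal i))
  no-short-cover = from-yes (all? λ i → ¬? (T? (reaches 8 (terminal i) (allFin 9 ∖ terminal i))))

  covering-walk : ∀ i j (w : Star PatchEdge (terminal i) (terminal j)) →
    (∀ q → q ∈ verts w) → 9 ≤ len w
  covering-walk i j w c with 9 ≤? len w
  ... | yes l = l
  ... | no ¬l = ⊥-elim (no-short-cover i
    (reaches-complete 8 w _ (s≤s⁻¹ (≰⇒> ¬l)) (isTerminal-terminal j) later))
    where
    isTerminal-terminal : ∀ j → T (isTerminal (terminal j))
    isTerminal-terminal = from-yes (all? λ j → T? (isTerminal (terminal j)))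
    later : ∀ {x} → x ∈ (allFin 9 ∖ terminal i) → x ∈ targets w
    later {x} m with c x | proj₂ (∈-filter⁻ (λ y → ¬? (terminal i ≟ᶠ y)) {xs = allFin 9} m)
    ... | here refl | i≢x = ⊥-elim (i≢x refl)
    ... | there r | _ = r

  -- Visits to the patch and what their contraction saves.

  -- A maximal stretch of a tour inside the patch, between the terminals through
  -- which it enters and leaves.
  record Visit : Set where
    constructor visit
    field
      {entry exit} : Fin 3
      path : Star PatchEdge (terminal entry) (terminal exit)

  open Visit

  Crossing : Visit → Set
  Crossing v = entry v ≢ exit v

  inside : List Visit → List (Fin 9)
  inside = concatMap (verts ∘ path)

  edges : List Visit → ℕ
  edges [] = 0
  edges (v ∷ vs) = len (path v) + edges vs

  length-inside : ∀ vs → length (inside vs) ≡ edges vs + length vs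
  length-inside [] = refl
  length-inside (v ∷ vs) = trans
    (cong suc (trans (length-++ (targets (path v))) (cong (len (path v) +_) (length-inside vs))))
    (arith (len (path v)) (edges vs) (length vs))
    where
    arith : ∀ a b c → suc (a + (b + c)) ≡ a + b + suc c
    arith = solve-∀

  -- The summand 2 * length ls accounts for the edges saved by deleting the loops.
  walk+loops : ∀ i j (w : Star PatchEdge (terminal i) (terminal j)) ls →
    (∀ q → q ∈ verts w ⊎ q ∈ inside ls) → 9 ≤ len w + (edges ls + 2 * length ls)
  walk+loops i j w [] c = ≤-trans (covering-walk i j w (λ q → [ id , (λ ()) ]′ (c q))) (m≤m+n _ _)
  -- With at least one loop, counting vertices suffices: a walk has one vertex more than edges, and
  -- the resulting excess `1 + length ls` is at most `2 * length ls`.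
  walk+loops i j w ls@(_ ∷ ls′) c = begin
    9
      ≤⟨ covering⇒length≥ (verts w ++ inside ls) (λ q → [ ∈-++⁺ˡ , ∈-++⁺ʳ (verts w) ]′ (c q)) ⟩
    length (verts w ++ inside ls)
      ≡⟨ length-++ (verts w) ⟩
    suc (len w) + length (inside ls)
      ≡⟨ cong (suc (len w) +_) (length-inside ls) ⟩
    suc (len w) + (edges ls + length ls)
      ≤⟨ m≤m+n _ (length ls′) ⟩
    suc (len w) + (edges ls + length ls) + length ls′
      ≡⟨ arith (len w) (edges ls) (length ls′) ⟩
    len w + (edges ls + 2 * length ls) ∎
    where
    open ≤-Reasoning
    arith : ∀ a b c → suc a + (b + suc c) + c ≡ a + (b + 2 * suc c)
    arith = solve-∀

  -- Two crossings share a terminal, since there are only three.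
  merge : ∀ a b → Crossing a → Crossing b → Σ Visit λ c →
    len (path c) ≡ len (path a) + len (path b) ×
    (∀ {x} → x ∈ verts (path a) ⊎ x ∈ verts (path b) → x ∈ verts (path c))
  merge (visit {i} {j} v) (visit {k} {l} w) i≢j k≢l
    with j ≟ᶠ k | j ≟ᶠ l | i ≟ᶠ k | i ≟ᶠ l
  ... | yes refl | _ | _ | _ =
    visit (v ◅◅ w) , len-◅◅ v w , [ verts-◅◅⁺ˡ v w , verts-◅◅⁺ʳ v w ]′
  ... | _ | yes refl | _ | _ = let w′ , e , c = reversal PatchEdge-sym w in
    visit (v ◅◅ w′) , trans (len-◅◅ v w′) (cong (len v +_) e) ,
      [ verts-◅◅⁺ˡ v w′ , verts-◅◅⁺ʳ v w′ ∘ c ]′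
  ... | _ | _ | yes refl | _ = let v′ , e , c = reversal PatchEdge-sym v in
    visit (v′ ◅◅ w) , trans (len-◅◅ v′ w) (cong (_+ len w) e) ,
      [ verts-◅◅⁺ˡ v′ w ∘ c , verts-◅◅⁺ʳ v′ w ]′
  ... | _ | _ | _ | yes refl =
    visit (w ◅◅ v) , trans (len-◅◅ w v) (+-comm (len w) (len v)) ,
      [ verts-◅◅⁺ʳ w v , verts-◅◅⁺ˡ w v ]′
  ... | no j≢k | no j≢l | no i≢k | no i≢l = ⊥-elim (three i j k l i≢j k≢l j≢k j≢l i≢k i≢l)
    where
    three : ∀ (i j k l : Fin 3) → i ≢ j → k ≢ l → j ≢ k → j ≢ l → i ≢ k → ¬ (i ≢ l)
    three = from-yes (all? λ (i : Fin 3) → all? λ j → all? λ k → all? λ (l : Fin 3) →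
      ¬? (i ≟ᶠ j) →-dec (¬? (k ≟ᶠ l) →-dec (¬? (j ≟ᶠ k) →-dec
        (¬? (j ≟ᶠ l) →-dec (¬? (i ≟ᶠ k) →-dec ¬? (¬? (i ≟ᶠ l)))))))

  crossing-edges : ∀ v → Crossing v → 3 ≤ len (path v)
  crossing-edges v = terminal-distance (path v) (entry v) (exit v) refl refl

  -- The sum on the right is what contraction saves: a crossing keeps its two outer edges as a
  -- passage through the root, while a loop loses them too.
  crossings-bound : ∀ v cs ls → All Crossing (v ∷ cs) →
    (∀ q → q ∈ inside (v ∷ cs) ⊎ q ∈ inside ls) →
    9 ≤ edges (v ∷ cs) + (edges ls + 2 * length ls)
  crossings-bound v [] ls _ c =
    subst (λ n → 9 ≤ n + (edges ls + 2 * length ls)) (sym (+-identityʳ (len (path v))))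
      (walk+loops _ _ (path v) ls
        (λ q → Sum.map₁ ([ id , (λ ()) ]′ ∘ ∈-++⁻ (verts (path v))) (c q)))
  crossings-bound v (w ∷ []) ls (cv ∷ cw ∷ []) c with merge v w cv cw
  ... | x , e , cx = subst (λ n → 9 ≤ n + (edges ls + 2 * length ls))
    (trans e (cong (len (path v) +_) (sym (+-identityʳ (len (path w))))))
    (walk+loops _ _ (path x) ls (λ q → Sum.map₁ cover (c q)))
    where
    cover : ∀ {q} → q ∈ inside (v ∷ w ∷ []) → q ∈ verts (path x)
    cover = cx ∘ Sum.map₂ ([ id , (λ ()) ]′ ∘ ∈-++⁻ (verts (path w))) ∘ ∈-++⁻ (verts (path v))
  -- Three crossings have at least 3 edges each, which makes 9.
  crossings-bound u (v ∷ w ∷ cs) ls (cu ∷ cv ∷ cw ∷ _) _ = ≤-trans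
    (+-mono-≤ (crossing-edges u cu) (+-mono-≤ (crossing-edges v cv)
      (≤-trans (crossing-edges w cw) (m≤m+n _ _))))
    (m≤m+n _ _)

  -- When all visits are loops, one of them has to be kept for the root to stay visited; the 2
  -- beyond 9 pays for it. The first loop acts as the walk of `walk+loops`, and its own deletion
  -- supplies this 2.
  loops-bound : ∀ ls → (∀ q → q ∈ inside ls) → 11 ≤ edges ls + 2 * length ls
  loops-bound [] c with c 0F
  ... | ()
  loops-bound (v ∷ ls) c = ≤-trans
    (+-monoˡ-≤ 2 (walk+loops _ _ (path v) ls (λ q → ∈-++⁻ (verts (path v)) (c q))))
    (≤-reflexive (arith (len (path v)) (edges ls) (length ls)))
    where
    arith : ∀ a b c → a + (b + 2 * c) + 2 ≡ a + b + 2 * suc c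
    arith = solve-∀

  loop? : (v : Visit) → Dec (entry v ≡ exit v)
  loop? v = entry v ≟ᶠ exit v

  loops crossings : List Visit → List Visit
  loops = filter loop?
  crossings = filter (¬? ∘ loop?)

  inside-partition : ∀ {q} vs → q ∈ inside vs → q ∈ inside (crossings vs) ⊎ q ∈ inside (loops vs)
  inside-partition (v ∷ vs) p with loop? v | ∈-++⁻ (verts (path v)) p
  ... | yes _ | inj₁ h = inj₂ (∈-++⁺ˡ h)
  ... | yes _ | inj₂ r = Sum.map₂ (∈-++⁺ʳ (verts (path v))) (inside-partition vs r)
  ... | no _ | inj₁ h = inj₁ (∈-++⁺ˡ h)
  ... | no _ | inj₂ r = Sum.map₁ (∈-++⁺ʳ (verts (path v))) (inside-partition vs r)

  cost-∷ : ∀ a b c → a + b + 2 * suc c ≡ a + 2 + (b + 2 * c)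
  cost-∷ = solve-∀

  -- Separates the two edges per crossing that survive contraction from the edges that are saved.
  cost-partition : ∀ vs → edges vs + 2 * length vs ≡
    2 * length (crossings vs) + (edges (crossings vs) + (edges (loops vs) + 2 * length (loops vs)))
  cost-partition [] = refl
  cost-partition (v ∷ vs) with loop? v
  ... | yes _ = trans (cost-∷ (len (path v)) (edges vs) (length vs))
    (trans (cong (len (path v) + 2 +_) (cost-partition vs))
      (arith (len (path v)) (length (crossings vs)) (edges (crossings vs))
        (edges (loops vs)) (length (loops vs))))
    where
    arith : ∀ a b c d e → a + 2 + (2 * b + (c + (d + 2 * e))) ≡ 2 * b + (c + (a + d + 2 * suc e))
    arith = solve-∀
  ... | no _ = trans (cost-∷ (len (path v)) (edges vs) (length vs))
    (trans (cong (len (path v) + 2 +_) (cost-partition vs))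
      (arith (len (path v)) (length (crossings vs)) (edges (crossings vs))
        (edges (loops vs)) (length (loops vs))))
    where
    arith : ∀ a b c d e → a + 2 + (2 * b + (c + (d + 2 * e))) ≡ 2 * suc b + (a + c + (d + 2 * e))
    arith = solve-∀

  -- Counting neighbours.

  indicator : Bool → ℕ
  indicator b = if b then 1 else 0

  -- Applied to a row of the adjacency function, this unfolds to the same sum as `degree`.
  count : ∀ {n} → (Fin n → Bool) → ℕ
  count {n} p = sum (map (λ w → indicator (p w)) (allFin n))

  count-cong : ∀ {n} {p q : Fin n → Bool} → (∀ i → p i ≡ q i) → count p ≡ count q
  count-cong {n} h = cong sum (map-cong (λ i → cong indicator (h i)) (allFin n))

  count-suc : ∀ {n} (p : Fin (suc n) → Bool) → count p ≡ indicator (p zero) + count (p ∘ suc)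
  count-suc p = cong (λ l → indicator (p zero) + sum l)
    (trans (map-tabulate suc (indicator ∘ p)) (sym (map-tabulate id (indicator ∘ p ∘ suc))))

  count-+ : ∀ a {b} (p : Fin (a + b) → Bool) → count p ≡ count (p ∘ (_↑ˡ b)) + count (p ∘ (a ↑ʳ_))
  count-+ zero p = refl
  count-+ (suc a) {b} p = begin
    count p
      ≡⟨ count-suc p ⟩
    indicator (p zero) + count (p ∘ suc)
      ≡⟨ cong (indicator (p zero) +_) (count-+ a (p ∘ suc)) ⟩
    indicator (p zero) + (count (p ∘ suc ∘ (_↑ˡ b)) + count (p ∘ (suc a ↑ʳ_)))
      ≡⟨ +-assoc (indicator (p zero)) _ _ ⟨
    indicator (p zero) + count (p ∘ suc ∘ (_↑ˡ b)) + count (p ∘ (suc a ↑ʳ_))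
      ≡⟨ cong (_+ count (p ∘ (suc a ↑ʳ_))) (count-suc (p ∘ (_↑ˡ b))) ⟨
    count (p ∘ (_↑ˡ b)) + count (p ∘ (suc a ↑ʳ_)) ∎
    where open ≡-Reasoning

  count-splitAt : ∀ a {b} (p : Fin a ⊎ Fin b → Bool) →
    count (p ∘ splitAt a) ≡ count (p ∘ inj₁) + count (p ∘ inj₂)
  count-splitAt a {b} p = trans (count-+ a (p ∘ splitAt a))
    (cong₂ _+_ (count-cong λ i → cong p (splitAt-↑ˡ a i b))
               (count-cong λ i → cong p (splitAt-↑ʳ a b i)))

  count-false : ∀ n → count {n} (const false) ≡ 0
  count-false zero = refl
  count-false (suc n) = trans (count-suc {n} (const false)) (count-false n)

  -- 3-connectivity, and disjoint paths to the terminals.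

  Off : ∀ {V : Set} → (V → V → Set) → Pred V _ → V → V → Set
  Off R U x y = R x y × ¬ U x × ¬ U y

  AtMostTwo : ∀ {V : Set} → Pred V _ → Set
  AtMostTwo U = ∀ {x y z} → U x → U y → U z → x ≡ y ⊎ x ≡ z ⊎ y ≡ z

  -- Removed sets are predicates with at most two elements: these pass easily
  -- through the bijections and the contraction below.
  Connected₃ : ∀ {V : Set} → (V → V → Set) → Set₁
  Connected₃ {V} R = (U : V → Set) → Decidable U → AtMostTwo U →
    ∀ u v → ¬ U u → ¬ U v → Star (Off R U) u v

  -- The vertices after q on three paths from q to the terminals that are disjoint
  -- apart from q.
  fan : Fin 9 → Fin 3 → List (Fin 9)
  fan 0F 0F = 3F ∷ []
  fan 0F 1F = 1F ∷ 5F ∷ []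
  fan 0F 2F = 2F ∷ 6F ∷ []
  fan 1F 0F = 0F ∷ 3F ∷ []
  fan 1F 1F = 5F ∷ []
  fan 1F 2F = 4F ∷ 6F ∷ []
  fan 2F 0F = 0F ∷ 3F ∷ []
  fan 2F 1F = 7F ∷ 5F ∷ []
  fan 2F 2F = 6F ∷ []
  fan 3F 0F = []
  fan 3F 1F = 0F ∷ 1F ∷ 5F ∷ []
  fan 3F 2F = 8F ∷ 4F ∷ 6F ∷ []
  fan 4F 0F = 8F ∷ 3F ∷ []
  fan 4F 1F = 1F ∷ 5F ∷ []
  fan 4F 2F = 6F ∷ []
  fan 5F 0F = 1F ∷ 0F ∷ 3F ∷ []
  fan 5F 1F = []
  fan 5F 2F = 7F ∷ 2F ∷ 6F ∷ []
  fan 6F 0F = 2F ∷ 0F ∷ 3F ∷ []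
  fan 6F 1F = 4F ∷ 1F ∷ 5F ∷ []
  fan 6F 2F = []
  fan 7F 0F = 8F ∷ 3F ∷ []
  fan 7F 1F = 5F ∷ []
  fan 7F 2F = 2F ∷ 6F ∷ []
  fan 8F 0F = 3F ∷ []
  fan 8F 1F = 7F ∷ 5F ∷ []
  fan 8F 2F = 4F ∷ 6F ∷ []

  isPath : Fin 9 → List (Fin 9) → Fin 9 → Bool
  isPath p [] q = isYes (p ≟ᶠ q)
  isPath p (r ∷ rs) q = patchAdj p r ∧ isPath r rs q

  fan-path : ∀ q t → T (isPath q (fan q t) (terminal t))
  fan-path = from-yes (all? λ q → all? λ t → T? (isPath q (fan q t) (terminal t)))

  fan-disjoint : ∀ q t t′ {p} → p ∈ fan q t → p ∈ fan q t′ → t ≡ t′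
  fan-disjoint q t t′ i j with from-yes (all? λ q → all? λ t → all? λ t′ →
    (t ≟ᶠ t′) ⊎-dec All.all? (λ p → ¬? (p ∈? fan q t′)) (fan q t)) q t t′
  ... | inj₁ eq = eq
  ... | inj₂ a = ⊥-elim (All.lookup a i j)

  -- Tour bounds and rooted graphs.

  Adj : ∀ {n} → SimpleGraph n → Fin n → Fin n → Set
  Adj G u v = T (SimpleGraph.adj G u v)

  ToursAtLeast : {V : Set} (R : V → V → Set) → ℕ → Set
  ToursAtLeast R b = ∀ x (w : Star R x x) → (∀ u → u ∈ verts w) → b ≤ len w

  port : ∀ {m} → Fin (3 + m) → Bool
  port o = [ const true , const false ]′ (splitAt 3 o)

  -- The vertex to be replaced is 0, and its neighbours are 1, 2 and 3.
  Rooted : ∀ {m} → SimpleGraph (4 + m) → Set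
  Rooted G = ∀ o → SimpleGraph.adj G zero (suc o) ≡ port o

  -- Replacing the root by the patch, and tours cut at their visits.

  module Expand {m : ℕ} (G : SimpleGraph (4 + m)) (rooted : Rooted G) where
    open SimpleGraph G

    -- inj₁ q is a vertex of the patch that replaces the vertex 0, and inj₂ o is the
    -- old vertex suc o.
    link : Fin 9 → Fin (3 + m) → Bool
    link q o = [ (λ t → isYes (q ≟ᶠ terminal t)) , const false ]′ (splitAt 3 o)

    adj′ : Fin 9 ⊎ Fin (3 + m) → Fin 9 ⊎ Fin (3 + m) → Bool
    adj′ (inj₁ p) (inj₁ q) = patchAdj p q
    adj′ (inj₁ p) (inj₂ o) = link p o
    adj′ (inj₂ o) (inj₁ p) = link p o
    adj′ (inj₂ o) (inj₂ o′) = adj (suc o) (suc o′)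

    Edge′ : Fin 9 ⊎ Fin (3 + m) → Fin 9 ⊎ Fin (3 + m) → Set
    Edge′ s t = T (adj′ s t)

    out : Fin 3 → Fin (3 + m)
    out t = t ↑ˡ m

    link⁻ : ∀ q o → T (link q o) → Σ (Fin 3) λ t → q ≡ terminal t × o ≡ out t
    link⁻ q o e with splitAt 3 o in eq
    ... | inj₁ t = t , toWitness {a? = q ≟ᶠ terminal t} e , sym (splitAt⁻¹-↑ˡ eq)

    root-edge : ∀ t → Adj G zero (suc (out t))
    root-edge t rewrite rooted (out t) | splitAt-↑ˡ 3 t m = tt

    root-edge′ : ∀ t → Adj G (suc (out t)) zero
    root-edge′ t = subst T (symm zero (suc (out t))) (root-edge t)

    -- A walk of the expanded graph between old vertices. The constructor `through` stands for a
    -- whole visit together with the edges that enter and leave the patch, hence the 2 per visit in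
    -- `length-track`.
    data Tour : Fin (3 + m) → Fin (3 + m) → Set where
      []      : ∀ {x} → Tour x x
      step    : ∀ {x y z} → Adj G (suc x) (suc y) → Tour y z → Tour x z
      through : ∀ {z} (v : Visit) → Tour (out (exit v)) z → Tour (out (entry v)) z

    track : ∀ {x z} → Tour x z → List (Fin 9 ⊎ Fin (3 + m))
    track [] = []
    track (step {y = y} _ t) = inj₂ y ∷ track t
    track (through v t) = map inj₁ (verts (path v)) ++ inj₂ (out (exit v)) ∷ track t

    steps : ∀ {x z} → Tour x z → ℕ
    steps [] = 0
    steps (step _ t) = suc (steps t)
    steps (through _ t) = steps t

    visits : ∀ {x z} → Tour x z → List Visit
    visits [] = []
    visits (step _ t) = visits t
    visits (through v t) = v ∷ visits t

    outs : ∀ {x z} → Tour x z → List (Fin (3 + m))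
    outs [] = []
    outs (step {y = y} _ t) = y ∷ outs t
    outs (through v t) = out (exit v) ∷ outs t

    length-track : ∀ {x z} (t : Tour x z) →
      length (track t) ≡ steps t + (edges (visits t) + 2 * length (visits t))
    length-track [] = refl
    length-track (step _ t) = cong suc (length-track t)
    length-track (through v t) = begin
      suc (length (map inj₁ (targets (path v)) ++ inj₂ (out (exit v)) ∷ track t))
        ≡⟨ cong suc (length-++ (map inj₁ (targets (path v)))) ⟩
      suc (length (map inj₁ (targets (path v))) + suc (length (track t)))
        ≡⟨ cong₂ (λ a b → suc (a + suc b)) (length-map inj₁ (targets (path v))) (length-track t) ⟩
      suc (len (path v) + suc (steps t + (edges (visits t) + 2 * length (visits t))))
        ≡⟨ arith (len (path v)) (steps t) (edges (visits t)) (length (visits t)) ⟩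
      steps t + (len (path v) + edges (visits t) + 2 * suc (length (visits t))) ∎
      where
      open ≡-Reasoning
      arith : ∀ a b c d → suc (a + suc (b + (c + 2 * d))) ≡ b + (a + c + 2 * suc d)
      arith = solve-∀

    track-outs : ∀ {x z o} (t : Tour x z) → inj₂ o ∈ track t → o ∈ outs t
    track-outs (step _ t) (here refl) = here refl
    track-outs (step _ t) (there p) = there (track-outs t p)
    track-outs (through v t) p with ∈-++⁻ (map inj₁ (verts (path v))) p
    ... | inj₁ q with () ← proj₂ (proj₂ (∈-map⁻ inj₁ q))
    ... | inj₂ (here refl) = here refl
    ... | inj₂ (there q) = there (track-outs t q)

    track-inside : ∀ {x z q} (t : Tour x z) → inj₁ q ∈ track t → q ∈ inside (visits t)
    track-inside (step _ t) (there p) = track-inside t p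
    track-inside (through v t) p with ∈-++⁻ (map inj₁ (verts (path v))) p
    ... | inj₁ q with _ , r , refl ← ∈-map⁻ inj₁ q = ∈-++⁺ˡ r
    ... | inj₂ (there q) = ∈-++⁺ʳ (verts (path v)) (track-inside t q)

    verts-snoc : ∀ {p q r} (a : Star PatchEdge p q) (e : PatchEdge q r) →
      verts (a ◅◅ e ◅ stop) ≡ verts a ++ r ∷ []
    verts-snoc stop e = refl
    verts-snoc {p} (f ◅ a) e = cong (p ∷_) (verts-snoc a e)

    mutual
      parse : ∀ {x z} (w : Star Edge′ (inj₂ x) (inj₂ z)) → Σ (Tour x z) λ t → track t ≡ targets w
      parse stop = [] , refl
      parse (_◅_ {j = inj₂ y} e w) with parse w
      ... | t , eq = step e t , cong (inj₂ y ∷_) eq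
      parse {x} (_◅_ {j = inj₁ q} e w) with link⁻ q x e
      ... | _ , refl , refl = parseInside stop w

      -- The walk `a` is the part of the current visit read so far. The whole walk ends at an old
      -- vertex, so this visit is left through a terminal at some point.
      parseInside : ∀ {i q z} (a : Star PatchEdge (terminal i) q) (w : Star Edge′ (inj₁ q) (inj₂ z)) →
        Σ (Tour (out i) z) λ t → track t ≡ map inj₁ (verts a) ++ targets w
      parseInside a (_◅_ {j = inj₁ p} e w) with parseInside (a ◅◅ e ◅ stop) w
      ... | t , eq = t , trans eq (trans
        (cong (λ l → map inj₁ l ++ targets w) (verts-snoc a e))
        (trans (cong (_++ targets w) (map-++ inj₁ (verts a) (p ∷ [])))
          (++-assoc (map inj₁ (verts a)) _ _)))
      parseInside {q = q} a (_◅_ {j = inj₂ y} e w) with link⁻ q y e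
      ... | _ , refl , refl with parse w
      ... | t , eq = through (visit a) t , cong (λ l → map inj₁ (verts a) ++ inj₂ y ∷ l) eq

    -- Contraction of tours.

    -- Contracts the patch to 0 and deletes all loops.
    pruned : ∀ {x z} → Tour x z → Star (Adj G) (suc x) (suc z)
    pruned [] = stop
    pruned (step e t) = e ◅ pruned t
    pruned (through v t) with loop? v
    ... | yes eq = subst (λ i → Star (Adj G) (suc (out i)) _) (sym eq) (pruned t)
    ... | no _ = root-edge′ (entry v) ◅ root-edge (exit v) ◅ pruned t

    len-pruned : ∀ {x z} (t : Tour x z) → len (pruned t) ≡ steps t + 2 * length (crossings (visits t))
    len-pruned [] = refl
    len-pruned (step e t) = cong suc (len-pruned t)
    len-pruned (through (visit {i} {j} p) t) with i ≟ᶠ j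
    ... | yes refl = len-pruned t
    ... | no _ = trans (cong (2 +_) (len-pruned t)) (arith (steps t) (length (crossings (visits t))))
      where
      arith : ∀ a b → 2 + (a + 2 * b) ≡ a + 2 * suc b
      arith = solve-∀

    -- A loop returns to the old vertex it started from, so its deletion loses no old vertex.
    pruned-outs : ∀ {x z o} (t : Tour x z) → o ∈ x ∷ outs t → suc o ∈ verts (pruned t)
    pruned-outs t (here refl) = here refl
    pruned-outs (step e t) (there p) = there (pruned-outs t p)
    pruned-outs (through (visit {i} {j} _) t) (there p) with i ≟ᶠ j
    ... | yes refl = pruned-outs t p
    ... | no _ = there (there (pruned-outs t p))

    pruned-root : ∀ {x z v} (t : Tour x z) → v ∈ crossings (visits t) → zero ∈ verts (pruned t)
    pruned-root (step e t) p = there (pruned-root t p)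
    pruned-root (through (visit {i} {j} _) t) p with i ≟ᶠ j
    ... | yes refl = pruned-root t p
    ... | no _ = there (here refl)

    -- As pruned, but keeps the first visit even if it is a loop.
    rooted-pruned : ∀ {x z} → Tour x z → Star (Adj G) (suc x) (suc z)
    rooted-pruned [] = stop
    rooted-pruned (step e t) = e ◅ rooted-pruned t
    rooted-pruned (through v t) = root-edge′ (entry v) ◅ root-edge (exit v) ◅ pruned t

    -- Only the first visit is treated differently, and keeping it costs two more edges only if it
    -- is a loop.
    len-rooted-pruned : ∀ {x z} (t : Tour x z) → len (rooted-pruned t) ≤ 2 + len (pruned t)
    len-rooted-pruned [] = z≤n
    len-rooted-pruned (step e t) = s≤s (len-rooted-pruned t)
    len-rooted-pruned (through (visit {i} {j} _) t) with i ≟ᶠ j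
    ... | yes refl = ≤-refl
    ... | no _ = m≤n+m _ 2

    rooted-pruned-outs : ∀ {x z o} (t : Tour x z) → o ∈ x ∷ outs t → suc o ∈ verts (rooted-pruned t)
    rooted-pruned-outs t (here refl) = here refl
    rooted-pruned-outs (step e t) (there p) = there (rooted-pruned-outs t p)
    rooted-pruned-outs (through v t) (there p) = there (there (pruned-outs t p))

    rooted-pruned-root : ∀ {x z q} (t : Tour x z) → q ∈ inside (visits t) → zero ∈ verts (rooted-pruned t)
    rooted-pruned-root (step e t) p = there (rooted-pruned-root t p)
    rooted-pruned-root (through v t) p = there (here refl)

    -- If some visit is a crossing, `pruned` still passes through the root and is a tour of `G`. If
    -- all are loops, `rooted-pruned` is a tour, and the two edges it keeps are covered by the 11 of
    -- `loops-bound`.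
    tour-bound : ∀ {b x} → ToursAtLeast (Adj G) b → (t : Tour x x) →
      (∀ o → o ∈ x ∷ outs t) → (∀ q → q ∈ inside (visits t)) → 9 + b ≤ length (track t)
    tour-bound {b} lb t co ci = subst (9 + b ≤_)
      (sym (trans (length-track t) (cong (steps t +_) (cost-partition vs)))) bound
      where
      vs = visits t
      cs = crossings vs
      ls = loops vs
      open ≤-Reasoning
      partition : ∀ q → q ∈ inside cs ⊎ q ∈ inside ls
      partition q = inside-partition vs (ci q)
      bound : 9 + b ≤ steps t + (2 * length cs + (edges cs + (edges ls + 2 * length ls)))
      -- The facts that mention `cs` are abstracted along with it, so that they specialise to each
      -- case.
      bound with cs in eq | all-filter (¬? ∘ loop?) vs | partition | len-pruned t
      ... | c ∷ cs′ | crossing | part | len-eq = begin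
        9 + b
          ≤⟨ +-mono-≤ (crossings-bound c cs′ ls crossing part) (lb _ (pruned t) λ
               { zero → pruned-root t (subst (c ∈_) (sym eq) (here refl))
               ; (suc o) → pruned-outs t (co o) }) ⟩
        p + len (pruned t)
          ≡⟨ cong (p +_) len-eq ⟩
        p + (steps t + 2 * length (c ∷ cs′))
          ≡⟨ arith p (steps t) (2 * length (c ∷ cs′)) ⟩
        steps t + (2 * length (c ∷ cs′) + p) ∎
        where
        p = edges (c ∷ cs′) + (edges ls + 2 * length ls)
        arith : ∀ a b c → a + (b + c) ≡ b + (c + a)
        arith = solve-∀
      ... | [] | _ | part | len-eq = begin
        9 + b
          ≤⟨ +-monoʳ-≤ 9 (lb _ (rooted-pruned t) λ
               -- The patch vertex `0F` lies on some visit, so there is a first visit to keep.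
               { zero → rooted-pruned-root t (ci 0F)
               ; (suc o) → rooted-pruned-outs t (co o) }) ⟩
        9 + len (rooted-pruned t)
          ≤⟨ +-monoʳ-≤ 9 (len-rooted-pruned t) ⟩
        11 + len (pruned t)
          ≡⟨ cong (11 +_) len-eq ⟩
        11 + (steps t + 0)
          ≡⟨ arith (steps t) ⟩
        steps t + 11
          ≤⟨ +-monoʳ-≤ (steps t) (loops-bound ls λ q → [ (λ ()) , id ]′ (part q)) ⟩
        steps t + (edges ls + 2 * length ls) ∎
        where
        arith : ∀ a → 11 + (a + 0) ≡ a + 11
        arith = solve-∀

    tours′ : ∀ {b} → ToursAtLeast (Adj G) b → ToursAtLeast Edge′ (9 + b)
    -- Started at an old vertex, the tour does not cut a visit in two at its ends.
    tours′ lb x w c with rotate w (c (inj₂ 0F))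
    ... | w′ , l , c′ with parse w′
    ... | t , eq = subst (9 + _ ≤_) (trans (cong length eq) l)
      (tour-bound lb t (λ o → outer (c′ (c (inj₂ o)))) (λ q → inner (c′ (c (inj₁ q)))))
      where
      outer : ∀ {o} → inj₂ o ∈ verts w′ → o ∈ 0F ∷ outs t
      outer (here refl) = here refl
      outer {o} (there p) = there (track-outs t (subst (inj₂ o ∈_) (sym eq) p))
      inner : ∀ {q} → inj₁ q ∈ verts w′ → q ∈ inside (visits t)
      inner {q} (there p) = track-inside t (subst (inj₁ q ∈_) (sym eq) p)

    -- The expanded graph: tours, root and degrees.

    expanded : SimpleGraph (12 + m)
    expanded = record
      { adj = λ u v → adj′ (splitAt 9 u) (splitAt 9 v)
      ; symm = λ u v → adj′-sym (splitAt 9 u) (splitAt 9 v)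
      ; irrefl = λ v → adj′-irrefl (splitAt 9 v)
      }
      where
      adj′-sym : ∀ s t → adj′ s t ≡ adj′ t s
      adj′-sym (inj₁ p) (inj₁ q) = patchAdj-sym p q
      adj′-sym (inj₁ p) (inj₂ o) = refl
      adj′-sym (inj₂ o) (inj₁ p) = refl
      adj′-sym (inj₂ o) (inj₂ o′) = symm (suc o) (suc o′)
      adj′-irrefl : ∀ s → ¬ T (adj′ s s)
      adj′-irrefl (inj₁ q) = from-yes (all? λ q → ¬? (T? (patchAdj q q))) q
      adj′-irrefl (inj₂ o) = irrefl (suc o)

    expanded-tours : ∀ {b} → ToursAtLeast (Adj G) b → ToursAtLeast (Adj expanded) (9 + b)
    expanded-tours lb x w c = subst (9 + _ ≤_)
      (trans (cong length image) (length-map (splitAt 9) (targets w)))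
      (tours′ lb _ w′ λ s →
        subst₂ _∈_ (splitAt-join 9 (3 + m) s) (cong (splitAt 9 x ∷_) (sym image))
          (∈-map⁺ (splitAt 9) (c (join 9 (3 + m) s))))
      where
      w′ = gmap {U = Edge′} (splitAt 9) id w
      image = targets-gmap {S = Edge′} (splitAt 9) id w

    -- The new root is the patch vertex `0F`. It is no terminal, and its neighbours are numbered 1,
    -- 2 and 3, so the expansion can be iterated.
    expanded-rooted : Rooted expanded
    expanded-rooted 0F = refl
    expanded-rooted 1F = refl
    expanded-rooted 2F = refl
    expanded-rooted 3F = refl
    expanded-rooted 4F = refl
    expanded-rooted 5F = refl
    expanded-rooted 6F = refl
    expanded-rooted 7F = refl
    expanded-rooted (suc (suc (suc (suc (suc (suc (suc (suc o)))))))) with splitAt 3 o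
    ... | inj₁ 0F = refl
    ... | inj₁ 1F = refl
    ... | inj₁ 2F = refl
    ... | inj₂ _ = refl

    -- A terminal has two neighbours in the patch and one outside, the other patch vertices have all
    -- three inside, and an old neighbour of the root exchanges the root for one terminal.
    expanded-cubic : Cubic G → Cubic expanded
    expanded-cubic cubic v = trans (count-splitAt 9 (adj′ (splitAt 9 v))) (deg (splitAt 9 v))
      where
      terminals : Fin 9 → Fin 3 → Bool
      terminals q t = isYes (q ≟ᶠ terminal t)
      inner : ∀ q → count (patchAdj q) + (count (terminals q) + 0) ≡ 3
      inner = from-yes (all? λ q → count (patchAdj q) + (count (terminals q) + 0) ≟ 3)
      links : ∀ o → count (λ q → link q o) ≡ indicator (port o)
      links o with splitAt 3 o
      ... | inj₁ 0F = refl
      ... | inj₁ 1F = refl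
      ... | inj₁ 2F = refl
      ... | inj₂ _ = refl
      deg : ∀ s → count (adj′ s ∘ inj₁) + count (adj′ s ∘ inj₂) ≡ 3
      deg (inj₁ q) = trans
        (cong (count (patchAdj q) +_)
          (trans (count-splitAt 3 {m} [ terminals q , const false ]′)
            (cong (count (terminals q) +_) (count-false m))))
        (inner q)
      deg (inj₂ o) = trans (cong (_+ count (adj (suc o) ∘ suc))
          (trans (links o) (cong indicator (trans (sym (rooted o)) (symm zero (suc o))))))
        (trans (sym (count-suc (adj (suc o)))) (cubic (suc o)))

    -- 3-connectivity of the expanded graph.

    module _ (U : Fin 9 ⊎ Fin (3 + m) → Set) (U? : Decidable U) (few : AtMostTwo U) where

      Walk : Fin 9 ⊎ Fin (3 + m) → Fin 9 ⊎ Fin (3 + m) → Set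
      Walk = Star (Off Edge′ U)

      -- The image of U under the contraction of the patch.
      contracted : Fin (4 + m) → Set
      contracted zero = ∃ λ q → U (inj₁ q)
      contracted (suc o) = U (inj₂ o)

      contracted? : Decidable contracted
      contracted? zero = any? λ q → U? (inj₁ q)
      contracted? (suc o) = U? (inj₂ o)

      contract : Fin 9 ⊎ Fin (3 + m) → Fin (4 + m)
      contract (inj₁ _) = zero
      contract (inj₂ o) = suc o

      uncontract : ∀ {x} → contracted x → ∃ λ s → U s × contract s ≡ x
      uncontract {zero} (q , u) = inj₁ q , u , refl
      uncontract {suc o} u = inj₂ o , u , refl

      contracted-few : AtMostTwo contracted
      contracted-few {x} {y} {z} a b c with uncontract {x} a | uncontract {y} b | uncontract {z} c
      ... | _ , u , refl | _ , v , refl | _ , w , refl =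
        Sum.map (cong contract) (Sum.map (cong contract) (cong contract)) (few u v w)

      link⁺ : ∀ t → T (link (terminal t) (out t))
      link⁺ t rewrite splitAt-↑ˡ 3 t m = fromWitness {a? = terminal t ≟ᶠ terminal t} refl

      leave : ∀ p l t → T (isPath p l (terminal t)) → ¬ U (inj₁ p) → All (¬_ ∘ U ∘ inj₁) l →
        ¬ U (inj₂ (out t)) → Walk (inj₁ p) (inj₂ (out t))
      leave p [] t e u _ v with toWitness {a? = p ≟ᶠ terminal t} e
      ... | refl = (link⁺ t , u , v) ◅ stop
      leave p (r ∷ l) t e u (ur ∷ us) v with Equivalence.to (T-∧ {patchAdj p r}) e
      ... | f , g = (f , u , ur) ◅ leave r l t g ur us v

      OnRoute : Fin 9 → Fin 3 → Fin 9 ⊎ Fin (3 + m) → Set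
      OnRoute q t = [ (_∈ fan q t) , (_≡ out t) ]′

      routes-disjoint : ∀ q {t t′} s → OnRoute q t s → OnRoute q t′ s → t ≡ t′
      routes-disjoint q (inj₁ _) = fan-disjoint q _ _
      routes-disjoint q (inj₂ _) a b = ↑ˡ-injective m _ _ (trans (sym a) b)

      Blocked : Fin 9 → Fin 3 → Set
      Blocked q t = Any (U ∘ inj₁) (fan q t) ⊎ U (inj₂ (out t))

      blocker : ∀ q {t} → Blocked q t → ∃ λ s → U s × OnRoute q t s
      blocker q (inj₁ b) = let p , i , u = find b in inj₁ p , u , i
      blocker q (inj₂ u) = inj₂ _ , u , refl

      -- If all three routes were blocked, two of the blockers would coincide by `few`, and one
      -- vertex would lie on two disjoint routes.
      unblocked : ∀ q → ∃ λ t → ¬ Blocked q t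
      unblocked q with blocked? 0F | blocked? 1F | blocked? 2F
        where
        blocked? : ∀ t → Dec (Blocked q t)
        blocked? t = Any.any? (U? ∘ inj₁) (fan q t) ⊎-dec U? (inj₂ (out t))
      ... | no b | _ | _ = 0F , b
      ... | yes _ | no b | _ = 1F , b
      ... | yes _ | yes _ | no b = 2F , b
      ... | yes a | yes b | yes c with blocker q a | blocker q b | blocker q c
      ... | s , us , rs | t , ut , rt | r , ur , rr with few us ut ur
      ... | inj₁ refl with () ← routes-disjoint q s rs rt
      ... | inj₂ (inj₁ refl) with () ← routes-disjoint q s rs rr
      ... | inj₂ (inj₂ refl) with () ← routes-disjoint q t rt rr

      -- Reduces connecting arbitrary remaining vertices to connecting old ones, where a walk of `G`
      -- can be lifted.
      escape : ∀ s → ¬ U s → ∃ λ o → ¬ U (inj₂ o) × Walk s (inj₂ o)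
      escape (inj₂ o) u = o , u , stop
      escape (inj₁ q) u with unblocked q
      ... | t , b = out t , b ∘ inj₂ ,
        leave q (fan q t) t (fan-path q t) u (¬Any⇒All¬ (fan q t) (b ∘ inj₁)) (b ∘ inj₂)

      root-neighbour : ∀ o → Adj G zero (suc o) → ∃ λ t → o ≡ out t
      root-neighbour o e with splitAt 3 o in eq | subst T (rooted o) e
      ... | inj₁ t | _ = t , sym (splitAt⁻¹-↑ˡ eq)

      -- A walk may use the root only if no patch vertex is removed, and then the fans are free
      -- inside the patch. The start is any `s` over `x`, because a walk at the root stands at
      -- whichever terminal it entered.
      lift : ∀ s {x o} → contract s ≡ x → Star (Off (Adj G) contracted) x (suc o) → Walk s (inj₂ o)
      lift (inj₂ o) refl stop = stop
      lift (inj₂ o) refl (_◅_ {j = suc o′} (e , u , v) w) = (e , u , v) ◅ lift (inj₂ o′) refl w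
      lift (inj₂ o) refl (_◅_ {j = zero} (e , u , v) w)
        with root-neighbour o (subst T (symm (suc o) zero) e)
      ... | t , refl = (link⁺ t , u , λ a → v (_ , a)) ◅ lift (inj₁ (terminal t)) refl w
      lift (inj₁ q) refl (_◅_ {j = zero} (e , _) w) = ⊥-elim (irrefl zero e)
      lift (inj₁ q) refl (_◅_ {j = suc o} (e , u , v) w) with root-neighbour o e
      ... | t , refl =
        leave q (fan q t) t (fan-path q t)
            (λ a → u (_ , a)) (All.universal (λ _ a → u (_ , a)) (fan q t)) v
          ◅◅ lift (inj₂ o) refl w

      Off-sym : ∀ {s t} → Off Edge′ U s t → Off Edge′ U t s
      Off-sym {inj₁ p} {inj₁ q} (e , u , v) = PatchEdge-sym e , v , u
      Off-sym {inj₁ p} {inj₂ q} (e , u , v) = e , v , u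
      Off-sym {inj₂ p} {inj₁ q} (e , u , v) = e , v , u
      Off-sym {inj₂ p} {inj₂ q} (e , u , v) = subst T (symm (suc p) (suc q)) e , v , u

      joined : Connected₃ (Adj G) → ∀ s t → ¬ U s → ¬ U t → Walk s t
      joined conn s t u v with escape s u | escape t v
      ... | o , ou , a | o′ , ou′ , b =
        a ◅◅ lift (inj₂ o) refl (conn contracted contracted? contracted-few (suc o) (suc o′) ou ou′)
          ◅◅ proj₁ (reversal Off-sym b)

    expanded-connected : Connected₃ (Adj G) → Connected₃ (Adj expanded)
    expanded-connected conn U U? few u v ¬u ¬v =
      subst₂ (Star (Off (Adj expanded) U)) (join-splitAt 9 _ u) (join-splitAt 9 _ v)
        (gmap glue (λ {s} {t} → edge s t)
          (joined (U ∘ glue) (λ s → U? _) few′ conn (splitAt 9 u) (splitAt 9 v)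
            (subst (¬_ ∘ U) (sym (join-splitAt 9 _ u)) ¬u)
            (subst (¬_ ∘ U) (sym (join-splitAt 9 _ v)) ¬v)))
      where
      glue = join 9 (3 + m)
      edge : ∀ s t → Off Edge′ (U ∘ glue) s t → Off (Adj expanded) U (glue s) (glue t)
      edge s t (e , p) = subst₂ Edge′ (sym (splitAt-join 9 _ s)) (sym (splitAt-join 9 _ t)) e , p
      glue-injective : ∀ {s t} → glue s ≡ glue t → s ≡ t
      glue-injective {s} {t} eq =
        trans (sym (splitAt-join 9 _ s)) (trans (cong (splitAt 9) eq) (splitAt-join 9 _ t))
      few′ : AtMostTwo (U ∘ glue)
      few′ a b c = Sum.map glue-injective (Sum.map glue-injective glue-injective) (few a b c)

  -- The base graph and the iterated family.

  K₄ : SimpleGraph 4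
  K₄ = record
    { adj = λ u v → isYes (¬? (u ≟ᶠ v))
    ; symm = from-yes (all? λ (u : Fin 4) → all? λ v → isYes (¬? (u ≟ᶠ v)) ≟ᵇ isYes (¬? (v ≟ᶠ u)))
    ; irrefl = from-yes (all? λ (v : Fin 4) → ¬? (T? (isYes (¬? (v ≟ᶠ v)))))
    }

  K₄-rooted : Rooted K₄
  K₄-rooted 0F = refl
  K₄-rooted 1F = refl
  K₄-rooted 2F = refl

  K₄-connected : Connected₃ (Adj K₄)
  K₄-connected U _ _ u v ¬u ¬v with u ≟ᶠ v
  ... | yes refl = stop
  ... | no u≢v = (fromWitness {a? = ¬? (u ≟ᶠ v)} u≢v , ¬u , ¬v) ◅ stop

  record LongToured (m b : ℕ) : Set₁ where
    field
      graph     : SimpleGraph (4 + m)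
      rooted    : Rooted graph
      cubic     : Cubic graph
      connected : Connected₃ (Adj graph)
      tours     : ToursAtLeast (Adj graph) b

  -- One expansion adds 8 and 9 to the indices, which matches `suc k * 8` and `suc k * 9` by
  -- computation.
  family : ∀ k → LongToured (k * 8) (k * 9 + 3)
  family zero = record
    { graph = K₄
    ; rooted = K₄-rooted
    ; cubic = from-yes (all? λ v → degree K₄ v ≟ 3)
    ; connected = K₄-connected
    -- Four vertices on a walk force three edges. The exact value 4 for the complete graph would
    -- only change an additive constant.
    ; tours = λ x w c → s≤s⁻¹ (covering⇒length≥ (verts w) c)
    }
  family (suc k) = record
    { graph = expanded
    ; rooted = expanded-rooted
    ; cubic = expanded-cubic cubic
    ; connected = expanded-connected connected
    ; tours = expanded-tours tours
    }
    where
    open LongToured (family k)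
    open Expand graph rooted

  -- Passage to walks, connectivity and tours given by lists.

  few-members : ∀ {A : Set} (xs : List A) → length xs < 3 → AtMostTwo (_∈ xs)
  few-members (_ ∷ []) _ (here refl) (here refl) _ = inj₁ refl
  few-members (_ ∷ _ ∷ []) _ (here refl) (here refl) _ = inj₁ refl
  few-members (_ ∷ _ ∷ []) _ (there (here refl)) (there (here refl)) _ = inj₁ refl
  few-members (_ ∷ _ ∷ []) _ (here refl) _ (here refl) = inj₂ (inj₁ refl)
  few-members (_ ∷ _ ∷ []) _ (there (here refl)) _ (there (here refl)) = inj₂ (inj₁ refl)
  few-members (_ ∷ _ ∷ []) _ _ (here refl) (here refl) = inj₂ (inj₂ refl)
  few-members (_ ∷ _ ∷ []) _ _ (there (here refl)) (there (here refl)) = inj₂ (inj₂ refl)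
  few-members (_ ∷ _ ∷ _ ∷ _) (s≤s (s≤s (s≤s ())))

  module _ {n} (G : SimpleGraph n) where

    walk⁺ : ∀ {X u v} (w : Star (Off (Adj G) (_∈ X)) u v) →
      IsWalk G u v (targets w) × All (_∉ X) (targets w)
    walk⁺ stop = ([-] , inj₁ (refl , refl)) , []
    walk⁺ ((e , _ , v) ◅ stop) = (e ∷ [-] , inj₂ ([] , refl)) , v ∷ []
    walk⁺ (_◅_ {j = y} (e , _ , v) w@(_ ◅ _)) with walk⁺ w
    ... | (l , inj₂ (ys , eq)) , a = (e ∷ l , inj₂ (y ∷ ys , cong (y ∷_) eq)) , v ∷ a

    walk⁻ : ∀ {u v} ws → IsWalk G u v ws → Σ (Star (Adj G) u v) λ w → targets w ≡ ws
    walk⁻ _ (_ , inj₁ (refl , refl)) = stop , refl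
    walk⁻ _ (e ∷ [-] , inj₂ ([] , refl)) = e ◅ stop , refl
    walk⁻ _ (e ∷ l , inj₂ (y ∷ ys , refl)) with walk⁻ _ (l , inj₂ (ys , refl))
    ... | w , eq = e ◅ w , cong (y ∷_) eq

    connected₃⇒KConnected : 3 < n → Connected₃ (Adj G) → KConnected G 3
    connected₃⇒KConnected 3<n conn = 3<n , λ X short u v u∉ v∉ →
      let w = conn (_∈ X) (λ x → DecMembership._∈?_ _≟ᶠ_ x X) (few-members X short) u v u∉ v∉
      in targets w , walk⁺ w

    tours-length : ∀ {b} → ToursAtLeast (Adj G) b → ∀ v ws → IsTSPTour G v ws → b ≤ length ws
    tours-length lb v ws (wk , c) with walk⁻ ws wk
    ... | w , refl = lb v w c

-- Arithmetic of the ratio and conclusion.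

open Graphs
open import Data.Nat as ℕ using (ℕ; suc)
import Data.Nat.Properties as ℕₚ
import Data.Nat.Tactic.RingSolver as ℕ-Solver
open import Data.Fin using (Fin)
open import Data.List using (List; length)
open import Data.Integer as ℤ using (+_; -[1+_])
import Data.Integer.Properties as ℤₚ
import Data.Integer.Tactic.RingSolver as ℤ-Solver
open import Data.Rational using (ℚ; mkℚ; 0ℚ; _/_; _-_; -_; _*_; _<_; _≤_; *<*; toℚᵘ)
import Data.Rational.Properties as ℚₚ
import Data.Rational.Unnormalised as ℚᵘ
import Data.Rational.Unnormalised.Properties as ℚᵘₚ
open import Data.Product using (Σ; _×_; _,_)
open import Relation.Binary.PropositionalEquality
  using (_≡_; refl; sym; trans; cong; cong₂; subst₂)

-- With q = (1 + p)/d and n = 4 + 8d, this is (9/8 - q) n ≤ l multiplied by 8d, with the negative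
-- term moved to the right to stay in the natural numbers.
natural-bound : ∀ p d l → d ℕ.* 9 ℕ.+ 3 ℕ.≤ l →
  9 ℕ.* d ℕ.* (4 ℕ.+ d ℕ.* 8) ℕ.≤ l ℕ.* (8 ℕ.* d) ℕ.+ suc p ℕ.* 8 ℕ.* (4 ℕ.+ d ℕ.* 8)
natural-bound p d l h = begin
  9 ℕ.* d ℕ.* (4 ℕ.+ d ℕ.* 8)
    -- The added term is the exact slack for `l` equal to `d * 9 + 3`.
    ≤⟨ ℕₚ.m≤m+n _ (52 ℕ.* d ℕ.+ 32 ℕ.+ p ℕ.* 8 ℕ.* (4 ℕ.+ d ℕ.* 8)) ⟩
  9 ℕ.* d ℕ.* (4 ℕ.+ d ℕ.* 8) ℕ.+ (52 ℕ.* d ℕ.+ 32 ℕ.+ p ℕ.* 8 ℕ.* (4 ℕ.+ d ℕ.* 8))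
    ≡⟨ arith p d ⟩
  (d ℕ.* 9 ℕ.+ 3) ℕ.* (8 ℕ.* d) ℕ.+ suc p ℕ.* 8 ℕ.* (4 ℕ.+ d ℕ.* 8)
    ≤⟨ ℕₚ.+-monoˡ-≤ _ (ℕₚ.*-monoˡ-≤ (8 ℕ.* d) h) ⟩
  l ℕ.* (8 ℕ.* d) ℕ.+ suc p ℕ.* 8 ℕ.* (4 ℕ.+ d ℕ.* 8) ∎
  where
  open ℕₚ.≤-Reasoning
  arith : ∀ p d → 9 ℕ.* d ℕ.* (4 ℕ.+ d ℕ.* 8) ℕ.+ (52 ℕ.* d ℕ.+ 32 ℕ.+ p ℕ.* 8 ℕ.* (4 ℕ.+ d ℕ.* 8)) ≡
    (d ℕ.* 9 ℕ.+ 3) ℕ.* (8 ℕ.* d) ℕ.+ suc p ℕ.* 8 ℕ.* (4 ℕ.+ d ℕ.* 8)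
  arith = ℕ-Solver.solve-∀

-- Moves the negative term back, in the shape that the operations on unnormalised fractions produce.
-- Here `p` is the full numerator.
integer-bound : ∀ p d n l → 9 ℕ.* d ℕ.* n ℕ.≤ l ℕ.* (8 ℕ.* d) ℕ.+ p ℕ.* 8 ℕ.* n →
  (+ 9 ℤ.* + d ℤ.+ (ℤ.- (+ p)) ℤ.* + 8) ℤ.* + n ℤ.≤ + l ℤ.* + (8 ℕ.* d)
integer-bound p d n l h = begin
  (+ 9 ℤ.* + d ℤ.+ (ℤ.- (+ p)) ℤ.* + 8) ℤ.* + n
    ≡⟨ left (+ d) (+ p) (+ n) ⟩
  + 9 ℤ.* + d ℤ.* + n ℤ.- + p ℤ.* + 8 ℤ.* + n
    ≡⟨ cong₂ ℤ._-_ (push 9 d n) (push p 8 n) ⟨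
  + (9 ℕ.* d ℕ.* n) ℤ.- + (p ℕ.* 8 ℕ.* n)
    ≤⟨ ℤₚ.+-monoˡ-≤ (ℤ.- + (p ℕ.* 8 ℕ.* n)) (ℤ.+≤+ h) ⟩
  + (l ℕ.* (8 ℕ.* d)) ℤ.+ + (p ℕ.* 8 ℕ.* n) ℤ.- + (p ℕ.* 8 ℕ.* n)
    ≡⟨ right (+ (l ℕ.* (8 ℕ.* d))) (+ (p ℕ.* 8 ℕ.* n)) ⟩
  + (l ℕ.* (8 ℕ.* d))
    ≡⟨ ℤₚ.pos-* l (8 ℕ.* d) ⟩
  + l ℤ.* + (8 ℕ.* d) ∎
  where
  open ℤₚ.≤-Reasoning
  push : ∀ a b c → + (a ℕ.* b ℕ.* c) ≡ + a ℤ.* + b ℤ.* + c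
  push a b c = trans (ℤₚ.pos-* (a ℕ.* b) c) (cong (ℤ._* + c) (ℤₚ.pos-* a b))
  left : ∀ d p n → (+ 9 ℤ.* d ℤ.+ (ℤ.- p) ℤ.* + 8) ℤ.* n ≡ + 9 ℤ.* d ℤ.* n ℤ.- p ℤ.* + 8 ℤ.* n
  left = ℤ-Solver.solve-∀
  right : ∀ a b → a ℤ.+ b ℤ.- b ≡ a
  right = ℤ-Solver.solve-∀

-- With d the denominator of q, q ≥ 1/d gives q(4 + 8d) ≥ 8, which absorbs the
-- difference 3/2 between 9/8 · (4 + 8d) and 9d + 3.
ratio-bound : ∀ q → 0ℚ < q → ∀ l → ℚ.denominatorℕ q ℕ.* 9 ℕ.+ 3 ℕ.≤ l →
  ((+ 9 / 8) - q) * (+ (4 ℕ.+ ℚ.denominatorℕ q ℕ.* 8) / 1) ≤ (+ l / 1)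
ratio-bound (mkℚ (+ 0) d-1 _) (*<* (ℤ.+<+ ()))
ratio-bound q@(mkℚ (+ suc p) d-1 _) _ l h = ℚₚ.toℚᵘ-cancel-≤ (begin
  toℚᵘ (((+ 9 / 8) - q) * (+ n / 1))
    ≃⟨ ℚₚ.toℚᵘ-homo-* ((+ 9 / 8) - q) (+ n / 1) ⟩
  toℚᵘ ((+ 9 / 8) - q) ℚᵘ.* toℚᵘ (+ n / 1)
    ≃⟨ ℚᵘₚ.*-cong (ℚₚ.toℚᵘ-homo-+ (+ 9 / 8) (- q)) (ℚₚ.toℚᵘ-fromℚᵘ (ℚᵘ.mkℚᵘ (+ n) 0)) ⟩
  (ℚᵘ.mkℚᵘ (+ 9) 7 ℚᵘ.+ ℚᵘ.mkℚᵘ -[1+ p ] d-1) ℚᵘ.* ℚᵘ.mkℚᵘ (+ n) 0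
    ≤⟨ ℚᵘ.*≤* (subst₂ ℤ._≤_ (sym (ℤₚ.*-identityʳ _))
         (cong (λ k → + l ℤ.* + k) (sym (ℕₚ.*-identityʳ (8 ℕ.* d))))
         (integer-bound (suc p) d n l (natural-bound p d l h))) ⟩
  ℚᵘ.mkℚᵘ (+ l) 0
    ≃⟨ ℚₚ.toℚᵘ-fromℚᵘ (ℚᵘ.mkℚᵘ (+ l) 0) ⟨
  toℚᵘ (+ l / 1) ∎)
  where
  open ℚᵘₚ.≤-Reasoning
  d = suc d-1
  n = 4 ℕ.+ d ℕ.* 8

theorem3 : (ε : ℚ) → 0ℚ < ε →
    Σ ℕ (λ n → Σ (SimpleGraph n) (λ G →
    KConnected G 3 × Cubic G ×
    (∀ (v : Fin n) (ws : List (Fin n)) → IsTSPTour G v ws →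
    ((+ 9 / 8) - ε) * (+ n / 1) ≤ (+ length ws / 1))))
theorem3 ε ε>0 =
  _ , graph , connected₃⇒KConnected graph (ℕₚ.m≤m+n 4 _) connected , cubic ,
  λ v ws t → ratio-bound ε ε>0 (length ws) (tours-length graph tours v ws t)
  -- Since ε is at least 1/d for its denominator d, d expansions make the additive constants
  -- harmless.
  where open LongToured (family (ℚ.denominatorℕ ε))
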